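{- Let $m$ and $n$ be positive integers such that $1<m\le n$. Then \[ \sum_{d=1}^n \mu(d)\, 2^{\lfloor\frac{n}{d} \rfloor - \lfloor \frac{n-1}{d} \rfloor + \lfloor\frac{m}{d} \rfloor - \lfloor \frac{m-1}{d} \rfloor} = \begin{cases} M(n) & \text{if } \gcd(m,n) >1, \\ 1 + M(n) & \text{if } \gcd(m,n)=1. \end{cases} \]
   Context: $\mu$ is the Möbius function and $M(n)=\sum_{d=1}^n\mu(d)$ is the Mertens function. $\lfloor x\rfloor$ is the floor of $x$. -}

module Defs where

open import Algebra.Properties.CommutativeMonoid.Sum using (sum)
open import Data.Fin.Base using (toℕ)
open import Data.Integer.Base using (ℤ; 0ℤ; -1ℤ; _^_)
open import Data.Integer.Properties using (+-0-commutativeMonoid)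
open import Data.List.Base using (List; length)
open import Data.List.Relation.Unary.Unique.DecPropositional using (unique?)
open import Data.Nat.Base using (ℕ; suc; NonZero)
open import Data.Nat.Primality.Factorisation using (factors; factorise)
open import Data.Nat.Properties using (_≟_)
open import Data.Bool.Base using (if_then_else_)
open import Relation.Nullary.Decidable.Core using (does)

-- The sum runs over d = 1, …, n, so that the summand may divide by d.
∑₁ : (n : ℕ) → ((d : ℕ) → .{{NonZero d}} → ℤ) → ℤ
∑₁ n f = sum +-0-commutativeMonoid {n} (λ i → f (suc (toℕ i)))

syntax ∑₁ n (λ d → t) = ∑[1≤ d ≤ n ] t

-- (-1)^k when the primes p₁, …, pₖ of the factorisation are pairwise
-- distinct, and 0 when some prime is repeated.
μ : (n : ℕ) → .{{NonZero n}} → ℤ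
μ n = if does (unique? _≟_ ps) then -1ℤ ^ length ps else 0ℤ
  where
  ps : List ℕ
  ps = factors (factorise n)

M : ℕ → ℤ
M n = ∑[1≤ d ≤ n ] μ d

{-# OPTIONS --safe #-}
-- For d ≥ 1 the difference ⌊n/d⌋ − ⌊(n−1)/d⌋ is the indicator of d ∣ n, and
-- 2^([d∣n] + [d∣m]) = (1 + [d∣n]) (1 + [d∣m]) = 1 + [d∣n] + [d∣m] + [d∣gcd m n].
-- So the sum is M(n) plus the sums of μ over the divisors of n, m and gcd m n,
-- and the sum of μ over the divisors of k vanishes unless k = 1: for a prime p
-- dividing k, the terms at e and at p e cancel when p ∤ e, and μ (p e) = 0 when p ∣ e.
module Submission where

open import Defs
open import Algebra.Properties.CommutativeMonoid.Sum using (sum; sum-cong-≗; sum-replicate-zero; ∑-distrib-+)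
open import Data.Bool.Base using (true; false; if_then_else_)
open import Data.Fin.Base using (toℕ)
open import Data.Integer.Base using (ℤ; +_; 0ℤ; 1ℤ; -1ℤ; -_) renaming (_+_ to _+ℤ_; _*_ to _*ℤ_; _^_ to _^ℤ_)
open import Data.Integer.Properties using (+-0-commutativeMonoid)
import Data.Integer.Properties as ℤ
open import Data.Integer.Solver using (module +-*-Solver)
open import Data.List.Base using (List; []; _∷_; length)
open import Data.List.Membership.Propositional using (_∈_; _∉_)
open import Data.List.Relation.Binary.Permutation.Propositional using (_↭_; ↭-sym; ↭⇒↭ₛ)
open import Data.List.Relation.Binary.Permutation.Propositional.Properties using (↭-length)
open import Data.List.Relation.Binary.Permutation.Setoid.Properties using (Unique-resp-↭)
open import Data.List.Relation.Unary.All using (_∷_; lookup)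
open import Data.List.Relation.Unary.All.Properties using (¬Any⇒All¬)
open import Data.List.Relation.Unary.AllPairs using (_∷_)
open import Data.List.Relation.Unary.Unique.DecPropositional using (unique?)
open import Data.List.Relation.Unary.Unique.Propositional using (Unique)
open import Data.Nat.Base using (ℕ; zero; suc; NonZero; >-nonZero; _+_; _*_; _∸_; _/_; _%_; _≤_; _<_; _>_; z≤n; s≤s)
open import Data.Nat.Divisibility using (_∣_; _∤_; _∣?_; divides; ∣-trans; ∣-refl; ∣m+n∣m⇒∣n; n∣m*n; m∣m*n; m*n∣⇒m∣; *-monoˡ-∣; >⇒∤)
open import Data.Nat.DivMod using (m≡m%n+[m/n]*n; m%n<n; m*n/n≡m; m<n⇒m/n≡0; +-distrib-/-∣ʳ)
open import Data.Nat.GCD using (gcd; gcd[m,n]∣m; gcd[m,n]∣n; gcd-greatest; gcd[m,n]≤n)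
open import Data.Nat.ListAction.Properties using (∈⇒∣product)
open import Data.Nat.Primality using (Prime; euclidsLemma; prime⇒nonZero)
open import Data.Nat.Primality.Factorisation using (PrimeFactorisation; factors; factorise; factorisationUnique; factorisationHasAllPrimeFactors)
open import Data.Nat.Properties using (_≟_; +-suc; +-assoc; *-comm; *-assoc; m+n∸n≡m; ≤-trans; <⇒≤; <-irrefl; m≤n⇒m<n∨m≡n; m*n≢0; m≤m*n; ≤-refl; +-identityʳ; +-comm; *-cancelʳ-≡)
open import Data.Product.Base using (_×_; _,_; ∃; uncurry)
open import Data.Sum.Base using (inj₁; inj₂)
open import Function.Base using (_∘_)
open import Function.Bundles using (_⇔_; mk⇔)
open import Relation.Binary.PropositionalEquality using (_≡_; refl; sym; trans; cong; cong₂; subst; setoid; module ≡-Reasoning)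
open import Relation.Nullary.Decidable using (does; yes; no; dec-true; dec-false; does-⇔; _×-dec_)
open import Relation.Nullary.Negation using (contradiction)

open +-*-Solver using (solve; _:=_; _:+_; _:*_; con)
open PrimeFactorisation using (isFactorisation; factorsPrime)

-- The Möbius function at a prime multiple.

signOfPrimes : List ℕ → ℤ
signOfPrimes ps = if does (unique? _≟_ ps) then -1ℤ ^ℤ length ps else 0ℤ

unique-↭ : ∀ {ps qs : List ℕ} → ps ↭ qs → Unique ps → Unique qs
unique-↭ = Unique-resp-↭ (setoid ℕ) ∘ ↭⇒↭ₛ

-- Length and distinctness survive reordering. This lets `p` be moved to the front of the prime list
-- of `d * p`, wherever `factorise` happens to put it.
signOfPrimes-↭ : ∀ {ps qs} → ps ↭ qs → signOfPrimes ps ≡ signOfPrimes qs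
signOfPrimes-↭ {ps} {qs} ps↭qs
  rewrite ↭-length ps↭qs
        | does-⇔ (mk⇔ (unique-↭ ps↭qs) (unique-↭ (↭-sym ps↭qs))) (unique? _≟_ ps) (unique? _≟_ qs)
  = refl

signOfPrimes-∈ : ∀ {p ps} → p ∈ ps → signOfPrimes (p ∷ ps) ≡ 0ℤ
signOfPrimes-∈ {p} {ps} p∈ps
  rewrite dec-false (unique? _≟_ (p ∷ ps)) (λ { (p≢ ∷ _) → lookup p≢ p∈ps refl })
  = refl

signOfPrimes-∉ : ∀ {p ps} → p ∉ ps → signOfPrimes (p ∷ ps) ≡ - signOfPrimes ps
signOfPrimes-∉ {p} {ps} p∉ps
  rewrite does-⇔ (mk⇔ (λ { (_ ∷ u) → u }) (¬Any⇒All¬ ps p∉ps ∷_)) (unique? _≟_ (p ∷ ps)) (unique? _≟_ ps)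
  with does (unique? _≟_ ps)
... | true  = ℤ.-1*i≡-i _
... | false = refl

module _ {p : ℕ} (pr : Prime p) (d : ℕ) .{{_ : NonZero d}} .{{d*p≢0 : NonZero (d * p)}} where

  private
    ps = factors (factorise d)

  -- Prepending `p` to the prime list of `d` factorises `d * p`, and factorisations are unique up to
  -- order.
  μ[d*p]≡signOfPrimes : μ (d * p) ≡ signOfPrimes (p ∷ ps)
  μ[d*p]≡signOfPrimes = signOfPrimes-↭ (factorisationUnique (factorise (d * p)) record
    { factors         = p ∷ ps
    ; isFactorisation = trans (*-comm d p) (cong (p *_) (isFactorisation (factorise d)))
    ; factorsPrime    = pr ∷ factorsPrime (factorise d)
    })

  p∣d⇒μ[d*p]≡0 : p ∣ d → μ (d * p) ≡ 0ℤ
  p∣d⇒μ[d*p]≡0 p∣d = trans μ[d*p]≡signOfPrimes (signOfPrimes-∈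
    (factorisationHasAllPrimeFactors pr (subst (p ∣_) (isFactorisation (factorise d)) p∣d)
      (factorsPrime (factorise d))))

  p∤d⇒μ[d*p]≡-μ[d] : p ∤ d → μ (d * p) ≡ - μ d
  p∤d⇒μ[d*p]≡-μ[d] p∤d = trans μ[d*p]≡signOfPrimes (signOfPrimes-∉ {ps = ps}
    (p∤d ∘ subst (p ∣_) (sym (isFactorisation (factorise d))) ∘ ∈⇒∣product {ns = ps}))

-- Finite sums: truncation and restriction to multiples.

∑₁-cong : ∀ n {f g : (d : ℕ) → .{{NonZero d}} → ℤ} → (∀ d → .{{_ : NonZero d}} → f d ≡ g d) →
          ∑₁ n f ≡ ∑₁ n g
∑₁-cong n f≡g = sum-cong-≗ +-0-commutativeMonoid {n} (λ i → f≡g (suc (toℕ i)))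

∑₁-+ : ∀ n (f g : (d : ℕ) → .{{NonZero d}} → ℤ) → ∑₁ n (λ d → f d +ℤ g d) ≡ ∑₁ n f +ℤ ∑₁ n g
∑₁-+ n f g = ∑-distrib-+ +-0-commutativeMonoid {n} _ _

∑₁-zero : ∀ n {f : (d : ℕ) → .{{NonZero d}} → ℤ} → (∀ d → .{{_ : NonZero d}} → f d ≡ 0ℤ) → ∑₁ n f ≡ 0ℤ
∑₁-zero n f≡0 = trans (∑₁-cong n f≡0) (sum-replicate-zero +-0-commutativeMonoid n)

∑₁-truncate : ∀ {q n} → q ≤ n → {f : (d : ℕ) → .{{NonZero d}} → ℤ} →
              (∀ d → .{{_ : NonZero d}} → q < d → f d ≡ 0ℤ) → ∑₁ n f ≡ ∑₁ q f
∑₁-truncate {n = n} z≤n {f} f≡0 = ∑₁-zero n {f} λ { (suc d) → f≡0 (suc d) (s≤s z≤n) }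
∑₁-truncate (s≤s q≤n) {f} f≡0 = cong (f 1 +ℤ_)
  (∑₁-truncate q≤n {λ d → f (suc d)} (λ d q<d → f≡0 (suc d) (s≤s q<d)))

-- Summands indexed from 0 carry no `NonZero` instance, so indices can be shifted freely in the
-- inductions below.
Σ : ℕ → (ℕ → ℤ) → ℤ
Σ n g = sum +-0-commutativeMonoid {n} (g ∘ toℕ)

Σ-cong : ∀ n {g h : ℕ → ℤ} → (∀ i → g i ≡ h i) → Σ n g ≡ Σ n h
Σ-cong n g≡h = sum-cong-≗ +-0-commutativeMonoid {n} (g≡h ∘ toℕ)

Σ-split : ∀ m n (g : ℕ → ℤ) → Σ (m + n) g ≡ Σ m g +ℤ Σ n (λ i → g (m + i))
Σ-split zero    n g = sym (ℤ.+-identityˡ _)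
Σ-split (suc m) n g = trans (cong (g 0 +ℤ_) (Σ-split m n (g ∘ suc))) (sym (ℤ.+-assoc (g 0) _ _))

-- Meant for a block of `suc p` consecutive indices, whose only multiple of `suc p` comes last.
Σ-last : ∀ n (g : ℕ → ℤ) → (∀ i → i < n → g i ≡ 0ℤ) → Σ (suc n) g ≡ g n
Σ-last zero    g g≡0 = ℤ.+-identityʳ (g 0)
Σ-last (suc n) g g≡0 = begin
  g 0 +ℤ Σ (suc n) (g ∘ suc) ≡⟨ cong₂ _+ℤ_ (g≡0 0 (s≤s z≤n)) (Σ-last n (g ∘ suc) (λ i i<n → g≡0 (suc i) (s≤s i<n))) ⟩
  0ℤ +ℤ g (suc n)            ≡⟨ ℤ.+-identityˡ _ ⟩
  g (suc n)                  ∎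
  where open ≡-Reasoning

-- The value at d ≥ 1 is g (d ∸ 1), so the e-th multiple of suc p, for e = suc i,
-- sits at index p + i * suc p.
Σ-multiples : ∀ q p (g : ℕ → ℤ) → (∀ i → suc p ∤ suc i → g i ≡ 0ℤ) →
              Σ (q * suc p) g ≡ Σ q (λ i → g (p + i * suc p))
Σ-multiples zero    p g g≡0 = refl
Σ-multiples (suc q) p g g≡0 = begin
  Σ (suc p + q * suc p) g
    ≡⟨ Σ-split (suc p) (q * suc p) g ⟩
  Σ (suc p) g +ℤ Σ (q * suc p) (λ i → g (suc p + i))
    ≡⟨ cong₂ _+ℤ_ (Σ-last p g λ i i<p → g≡0 i (>⇒∤ (s≤s i<p)))
                  (Σ-multiples q p (λ i → g (suc p + i)) λ i p∤i → g≡0 (suc p + i)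
                    λ p∣ → p∤i (∣m+n∣m⇒∣n (subst (suc p ∣_) (sym (+-suc (suc p) i)) p∣) ∣-refl)) ⟩
  g p +ℤ Σ q (λ i → g (suc p + (p + i * suc p)))
    ≡⟨ cong₂ _+ℤ_ (cong g (sym (+-identityʳ p)))
                  (Σ-cong q λ i → cong g (sym (+-suc p (p + i * suc p)))) ⟩
  g (p + 0) +ℤ Σ q (λ i → g (p + suc i * suc p))
    ∎
  where open ≡-Reasoning

∑₁-multiples : ∀ q p .{{_ : NonZero p}} (f : (d : ℕ) → .{{NonZero d}} → ℤ) →
               (∀ d → .{{_ : NonZero d}} → p ∤ d → f d ≡ 0ℤ) →
               ∑₁ (q * p) f ≡ ∑₁ q (λ d → f (d * p) {{m*n≢0 d p}})
-- `suc (p + i * suc p)` is definitionally `suc i * suc p`, so the two indexings agree on the nose.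
∑₁-multiples q (suc p) f f≡0 = Σ-multiples q p (λ i → f (suc i)) (λ i → f≡0 (suc i))

-- Sums of the Möbius function over divisors.

μ∣ : ℕ → (d : ℕ) → .{{NonZero d}} → ℤ
μ∣ k d = if does (d ∣? k) then μ d else 0ℤ

∤⇒μ∣≡0 : ∀ k d .{{_ : NonZero d}} → d ∤ k → μ∣ k d ≡ 0ℤ
∤⇒μ∣≡0 k d d∤k rewrite dec-false (d ∣? k) d∤k = refl

∣⇒μ∣≡μ : ∀ k d .{{_ : NonZero d}} → d ∣ k → μ∣ k d ≡ μ d
∣⇒μ∣≡μ k d d∣k rewrite dec-true (d ∣? k) d∣k = refl

∑₁-μ∣1 : ∀ {n} → 1 ≤ n → ∑₁ n (μ∣ 1) ≡ 1ℤ
∑₁-μ∣1 1≤n = ∑₁-truncate 1≤n {μ∣ 1} (λ d 1<d → ∤⇒μ∣≡0 1 d (>⇒∤ 1<d))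

-- In `q * p ≡ c * d` the prime `p` must divide the cofactor `c`, and can then be cancelled.
∣*-prime : ∀ {p d q} .{{_ : NonZero p}} → Prime p → p ∤ d → d ∣ q * p → d ∣ q
∣*-prime {p} {d} {q} pr p∤d (divides c qp≡cd)
  with euclidsLemma c d pr (divides q (sym qp≡cd))
... | inj₂ p∣d            = contradiction p∣d p∤d
... | inj₁ (divides b c≡bp) = divides b (*-cancelʳ-≡ q (b * d) p (begin
  q * p       ≡⟨ qp≡cd ⟩
  c * d       ≡⟨ cong (_* d) c≡bp ⟩
  b * p * d   ≡⟨ *-assoc b p d ⟩
  b * (p * d) ≡⟨ cong (b *_) (*-comm p d) ⟩
  b * (d * p) ≡⟨ *-assoc b d p ⟨
  b * d * p   ∎))
  where open ≡-Reasoning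

module _ {p q n : ℕ} .{{_ : NonZero p}} .{{_ : NonZero q}} (pr : Prime p) (qp≤n : q * p ≤ n) where

  private
    k = q * p

    -- The split by `p ∣ d` brings both halves to the range from 1 to `q`: a divisor of `k` prime to
    -- `p` already divides `q`, and a multiple of `p` up to `k` is `e * p` with `e ≤ q`. Here
    -- `p ∣ q` is allowed.
    A B : (d : ℕ) → .{{NonZero d}} → ℤ
    A d = if does (p ∣? d) then 0ℤ else μ∣ k d
    B d = if does (p ∣? d) then μ∣ k d else 0ℤ

    A+B : ∀ d .{{_ : NonZero d}} → μ∣ k d ≡ A d +ℤ B d
    A+B d with does (p ∣? d)
    ... | true  = sym (ℤ.+-identityˡ _)
    ... | false = sym (ℤ.+-identityʳ _)

    A-support : ∀ d .{{_ : NonZero d}} → q < d → A d ≡ 0ℤ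
    A-support d q<d with p ∣? d
    ... | yes _   = refl
    ... | no  p∤d = ∤⇒μ∣≡0 k d (>⇒∤ q<d ∘ ∣*-prime {q = q} pr p∤d)

    B-support : ∀ d .{{_ : NonZero d}} → k < d → B d ≡ 0ℤ
    B-support d k<d with does (p ∣? d)
    ... | true  = ∤⇒μ∣≡0 k d (>⇒∤ {{m*n≢0 q p}} k<d)
    ... | false = refl

    B-multiple : ∀ d .{{_ : NonZero d}} → p ∤ d → B d ≡ 0ℤ
    B-multiple d p∤d rewrite dec-false (p ∣? d) p∤d = refl

    -- If `p ∣ d`, the first term is 0 by definition and `μ (d * p)` vanishes. If `p ∤ d` and
    -- `d ∣ k`, then `d ∣ q`, so `d * p ∣ k` and the two values are opposite. If `d ∤ k`, then
    -- `d * p ∤ k` either.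
    cancel : ∀ d .{{_ : NonZero d}} → A d +ℤ B (d * p) {{m*n≢0 d p}} ≡ 0ℤ
    cancel d rewrite dec-true (p ∣? d * p) (n∣m*n d) with p ∣? d | d ∣? k
    ... | yes p∣d | _ = trans (ℤ.+-identityˡ (μ∣ k (d * p) {{m*n≢0 d p}})) vanish
      where
      vanish : μ∣ k (d * p) {{m*n≢0 d p}} ≡ 0ℤ
      vanish with does (d * p ∣? k)
      ... | true  = p∣d⇒μ[d*p]≡0 pr d {{d*p≢0 = m*n≢0 d p}} p∣d
      ... | false = refl
    ... | no p∤d | yes d∣k = trans
      (cong (μ d +ℤ_) (trans (∣⇒μ∣≡μ k (d * p) {{m*n≢0 d p}} (*-monoˡ-∣ p (∣*-prime {q = q} pr p∤d d∣k)))
                             (p∤d⇒μ[d*p]≡-μ[d] pr d {{d*p≢0 = m*n≢0 d p}} p∤d)))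
      (ℤ.+-inverseʳ (μ d))
    ... | no _   | no d∤k = trans (ℤ.+-identityˡ (μ∣ k (d * p) {{m*n≢0 d p}}))
      (∤⇒μ∣≡0 k (d * p) {{m*n≢0 d p}} (d∤k ∘ m*n∣⇒m∣ d p))

  ∑₁-μ∣q*p : ∑₁ n (μ∣ k) ≡ 0ℤ
  ∑₁-μ∣q*p = begin
    ∑₁ n (μ∣ k)
      ≡⟨ ∑₁-cong n A+B ⟩
    ∑₁ n (λ d → A d +ℤ B d)
      ≡⟨ ∑₁-+ n A B ⟩
    ∑₁ n A +ℤ ∑₁ n B
      ≡⟨ cong₂ _+ℤ_ (∑₁-truncate q≤n {A} A-support)
                    (trans (∑₁-truncate qp≤n {B} B-support) (∑₁-multiples q p B B-multiple)) ⟩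
    ∑₁ q A +ℤ ∑₁ q (λ d → B (d * p) {{m*n≢0 d p}})
      ≡⟨ ∑₁-+ q A (λ d → B (d * p) {{m*n≢0 d p}}) ⟨
    ∑₁ q (λ d → A d +ℤ B (d * p) {{m*n≢0 d p}})
      ≡⟨ ∑₁-zero q cancel ⟩
    0ℤ
      ∎
    where
    open ≡-Reasoning
    q≤n : q ≤ n
    q≤n = ≤-trans (m≤m*n q p) qp≤n

∃-primeDivisor : ∀ {k} → 1 < k → ∃ λ p → Prime p × p ∣ k
∃-primeDivisor {k@(suc _)} 1<k with factorise k
... | record { factors = [] ; isFactorisation = k≡1 } = contradiction 1<k (<-irrefl (sym k≡1))
... | record { factors = p ∷ ps ; isFactorisation = k≡ ; factorsPrime = pr ∷ _ } =
  p , pr , subst (p ∣_) (sym k≡) (m∣m*n _)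

∑₁-μ∣ : ∀ {n k} → 1 < k → k ≤ n → ∑₁ n (μ∣ k) ≡ 0ℤ
∑₁-μ∣ 1<k k≤n with ∃-primeDivisor 1<k
-- A zero cofactor would force `k` to be 0.
... | p     , pr , divides zero      refl = contradiction 1<k λ ()
... | p     , pr , divides (suc q-1) refl = ∑₁-μ∣q*p {q = suc q-1} {{prime⇒nonZero pr}} pr k≤n

-- The exponent as a sum of divisibility indicators.

𝟙[_∣_] : ℕ → ℕ → ℕ
𝟙[ d ∣ k ] = if does (d ∣? k) then 1 else 0

-- Adding 1 to `k` either completes the remainder to `d`, raising the quotient by 1, or leaves a
-- nonzero remainder below `d` and the same quotient.
suc-/ : ∀ k d .{{_ : NonZero d}} → suc k / d ≡ 𝟙[ d ∣ suc k ] + k / d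
suc-/ k d@(suc d-1) with m≤n⇒m<n∨m≡n (m%n<n k d)
... | inj₂ 1+r≡d = begin
  suc k / d                 ≡⟨ cong (_/ d) 1+k≡ ⟩
  (suc q * d) / d           ≡⟨ m*n/n≡m (suc q) d ⟩
  1 + q                     ≡⟨ cong (λ b → (if b then 1 else 0) + q) (dec-true (d ∣? suc k) (divides (suc q) 1+k≡)) ⟨
  𝟙[ d ∣ suc k ] + q        ∎
  where
  open ≡-Reasoning
  q = k / d
  1+k≡ : suc k ≡ suc q * d
  1+k≡ = trans (cong suc (m≡m%n+[m/n]*n k d)) (cong (_+ q * d) 1+r≡d)
... | inj₁ 1+r<d = begin
  suc k / d                 ≡⟨ cong (_/ d) 1+k≡ ⟩
  (suc r + q * d) / d       ≡⟨ +-distrib-/-∣ʳ (suc r) (n∣m*n q) ⟩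
  suc r / d + q * d / d     ≡⟨ cong₂ _+_ (m<n⇒m/n≡0 1+r<d) (m*n/n≡m q d) ⟩
  q                         ≡⟨ cong (λ b → (if b then 1 else 0) + q) (dec-false (d ∣? suc k) d∤1+k) ⟨
  𝟙[ d ∣ suc k ] + q        ∎
  where
  open ≡-Reasoning
  q = k / d
  r = k % d
  1+k≡ : suc k ≡ suc r + q * d
  1+k≡ = cong suc (m≡m%n+[m/n]*n k d)
  d∤1+k : d ∤ suc k
  d∤1+k d∣ = >⇒∤ 1+r<d (∣m+n∣m⇒∣n (subst (d ∣_) (trans 1+k≡ (+-comm (suc r) (q * d))) d∣) (n∣m*n q))

-- The expression associates to the left, so the last `∸` applies to everything before it.
-- Truncation never takes effect: by `suc-/` each subtracted quotient is contained in what it is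
-- taken from.
exponent≡ : ∀ m n d .{{_ : NonZero m}} .{{_ : NonZero n}} .{{_ : NonZero d}} →
            n / d ∸ (n ∸ 1) / d + m / d ∸ (m ∸ 1) / d ≡ 𝟙[ d ∣ n ] + 𝟙[ d ∣ m ]
exponent≡ m@(suc m-1) n@(suc n-1) d = begin
  n / d ∸ n-1 / d + m / d ∸ m-1 / d
    ≡⟨ cong₂ (λ x y → x ∸ n-1 / d + y ∸ m-1 / d) (suc-/ n-1 d) (suc-/ m-1 d) ⟩
  𝟙[ d ∣ n ] + n-1 / d ∸ n-1 / d + (𝟙[ d ∣ m ] + m-1 / d) ∸ m-1 / d
    ≡⟨ cong (λ x → x + (𝟙[ d ∣ m ] + m-1 / d) ∸ m-1 / d) (m+n∸n≡m 𝟙[ d ∣ n ] (n-1 / d)) ⟩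
  𝟙[ d ∣ n ] + (𝟙[ d ∣ m ] + m-1 / d) ∸ m-1 / d
    ≡⟨ cong (_∸ m-1 / d) (+-assoc 𝟙[ d ∣ n ] 𝟙[ d ∣ m ] (m-1 / d)) ⟨
  𝟙[ d ∣ n ] + 𝟙[ d ∣ m ] + m-1 / d ∸ m-1 / d
    ≡⟨ m+n∸n≡m (𝟙[ d ∣ n ] + 𝟙[ d ∣ m ]) (m-1 / d) ⟩
  𝟙[ d ∣ n ] + 𝟙[ d ∣ m ]
    ∎
  where open ≡-Reasoning

-- Expanding the power of 2 and evaluating the sum.

∣gcd⇔ : ∀ m n {d} → d ∣ gcd m n ⇔ (d ∣ m × d ∣ n)
∣gcd⇔ m n = mk⇔ (λ d∣g → ∣-trans d∣g (gcd[m,n]∣m m n) , ∣-trans d∣g (gcd[m,n]∣n m n))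
                (uncurry gcd-greatest)

μ*2^≡ : ∀ m n d .{{_ : NonZero d}} →
        μ d *ℤ (+ 2) ^ℤ (𝟙[ d ∣ n ] + 𝟙[ d ∣ m ]) ≡ μ d +ℤ μ∣ n d +ℤ μ∣ m d +ℤ μ∣ (gcd m n) d
μ*2^≡ m n d
  -- The test for `gcd m n` becomes the conjunction of the other two, so four cases remain, with
  -- powers 4, 2, 2 and 1.
  rewrite does-⇔ (∣gcd⇔ m n) (d ∣? gcd m n) (d ∣? m ×-dec d ∣? n)
  with does (d ∣? m) | does (d ∣? n)
... | true  | true  = solve 1 (λ x → x :* con (+ 4) := x :+ x :+ x :+ x) refl (μ d)
... | true  | false = solve 1 (λ x → x :* con (+ 2) := x :+ con 0ℤ :+ x :+ con 0ℤ) refl (μ d)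
... | false | true  = solve 1 (λ x → x :* con (+ 2) := x :+ x :+ con 0ℤ :+ con 0ℤ) refl (μ d)
... | false | false = solve 1 (λ x → x :* con 1ℤ := x :+ con 0ℤ :+ con 0ℤ :+ con 0ℤ) refl (μ d)

-- The divisor sums of `n` and `m` vanish, since both numbers exceed 1 and have all their divisors
-- within the range of summation.
∑₁-μ*2^≡ : ∀ m n → 1 < m → m ≤ n →
           ∑[1≤ d ≤ n ] (μ d *ℤ (+ 2) ^ℤ (n / d ∸ (n ∸ 1) / d + m / d ∸ (m ∸ 1) / d))
             ≡ M n +ℤ ∑₁ n (μ∣ (gcd m n))
∑₁-μ*2^≡ m@(suc _) n@(suc _) 1<m m≤n = begin
  ∑[1≤ d ≤ n ] (μ d *ℤ (+ 2) ^ℤ (n / d ∸ (n ∸ 1) / d + m / d ∸ (m ∸ 1) / d))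
    ≡⟨ ∑₁-cong n (λ d → trans (cong (λ e → μ d *ℤ (+ 2) ^ℤ e) (exponent≡ m n d)) (μ*2^≡ m n d)) ⟩
  ∑[1≤ d ≤ n ] (μ d +ℤ μ∣ n d +ℤ μ∣ m d +ℤ μ∣ (gcd m n) d)
    ≡⟨ ∑₁-+ n (λ d → μ d +ℤ μ∣ n d +ℤ μ∣ m d) (μ∣ (gcd m n)) ⟩
  ∑[1≤ d ≤ n ] (μ d +ℤ μ∣ n d +ℤ μ∣ m d) +ℤ G
    ≡⟨ cong (_+ℤ G) (∑₁-+ n (λ d → μ d +ℤ μ∣ n d) (μ∣ m)) ⟩
  ∑[1≤ d ≤ n ] (μ d +ℤ μ∣ n d) +ℤ ∑₁ n (μ∣ m) +ℤ G
    ≡⟨ cong (λ x → x +ℤ ∑₁ n (μ∣ m) +ℤ G) (∑₁-+ n (λ d → μ d) (μ∣ n)) ⟩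
  M n +ℤ ∑₁ n (μ∣ n) +ℤ ∑₁ n (μ∣ m) +ℤ G
    ≡⟨ cong₂ (λ x y → M n +ℤ x +ℤ y +ℤ G) (∑₁-μ∣ (≤-trans 1<m m≤n) ≤-refl) (∑₁-μ∣ 1<m m≤n) ⟩
  M n +ℤ 0ℤ +ℤ 0ℤ +ℤ G
    ≡⟨ cong (_+ℤ G) (trans (ℤ.+-identityʳ (M n +ℤ 0ℤ)) (ℤ.+-identityʳ (M n))) ⟩
  M n +ℤ G
    ∎
  where
  open ≡-Reasoning
  G = ∑₁ n (μ∣ (gcd m n))

theorem4p1 : (m n : ℕ) → 1 < m → m ≤ n →
    let S = ∑[1≤ d ≤ n ] (μ d *ℤ (+ 2) ^ℤ (n / d ∸ (n ∸ 1) / d + m / d ∸ (m ∸ 1) / d))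
    in (gcd m n > 1 → S ≡ M n) × (gcd m n ≡ 1 → S ≡ 1ℤ +ℤ M n)
theorem4p1 m n 1<m m≤n = gcd>1 , gcd≡1
  where
  open ≡-Reasoning
  S = ∑[1≤ d ≤ n ] (μ d *ℤ (+ 2) ^ℤ (n / d ∸ (n ∸ 1) / d + m / d ∸ (m ∸ 1) / d))
  S≡ : S ≡ M n +ℤ ∑₁ n (μ∣ (gcd m n))
  S≡ = ∑₁-μ*2^≡ m n 1<m m≤n
  1≤n : 1 ≤ n
  1≤n = ≤-trans (<⇒≤ 1<m) m≤n

  gcd>1 : gcd m n > 1 → S ≡ M n
  gcd>1 g>1 = begin
    S                            ≡⟨ S≡ ⟩
    -- `gcd m n ≤ n` ensures that no divisor of the gcd is missed.
    M n +ℤ ∑₁ n (μ∣ (gcd m n))   ≡⟨ cong (M n +ℤ_) (∑₁-μ∣ g>1 (gcd[m,n]≤n m n {{>-nonZero 1≤n}})) ⟩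
    M n +ℤ 0ℤ                    ≡⟨ ℤ.+-identityʳ (M n) ⟩
    M n                          ∎

  gcd≡1 : gcd m n ≡ 1 → S ≡ 1ℤ +ℤ M n
  gcd≡1 g≡1 = begin
    S                            ≡⟨ S≡ ⟩
    M n +ℤ ∑₁ n (μ∣ (gcd m n))   ≡⟨ cong (λ g → M n +ℤ ∑₁ n (μ∣ g)) g≡1 ⟩
    -- Only `d = 1` divides 1, and it contributes `μ 1`, the sign of the empty prime list.
    M n +ℤ ∑₁ n (μ∣ 1)           ≡⟨ cong (M n +ℤ_) (∑₁-μ∣1 1≤n) ⟩
    M n +ℤ 1ℤ                    ≡⟨ ℤ.+-comm (M n) 1ℤ ⟩
    1ℤ +ℤ M n                    ∎
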